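{- Let $r,s\ge 1$ and $t\ge 2$ be integers, and let $P^t_{r,s}$ denote the number of $t$-cores $\lambda$ whose Young diagram fits inside the $r\times s$ rectangle (i.e. $\ell(\lambda)\le r$ and $\lambda_1\le s$). For $0\le i\le t-1$ let $n_i=\left\lfloor \frac{r+s+t-1-i}{t}\right\rfloor$. Then $$P^t_{r,s}=[q^r]\prod_{i=0}^{t-1}\left(1+q+\cdots+q^{n_i}\right).$$
   Context: A partition $\lambda=(\lambda_1\ge\lambda_2\ge\cdots)$ is a weakly decreasing finite sequence of positive integers (possibly empty); $\ell(\lambda)$ is its number of parts, and $\lambda_1=0$ if $\lambda$ is empty. A rim-hook of $\lambda$ is a connected skew shape $\lambda/\mu$ (with $\mu\subseteq\lambda$ a partition) containing no $2\times 2$ block of boxes; a $t$-rim hook is a rim-hook with exactly $t$ boxes. A partition is a $t$-core if no $t$-rim hook can be removed from it so as to leave the Young diagram of a partition. For a polynomial $p(q)$, $[q^n]p(q)$ denotes the coefficient of $q^n$. -}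

module Defs where

open import Data.List.Base using (List; []; _∷_; length; map; foldr; replicate; upTo)
open import Data.List.Membership.Propositional using (_∈_)
open import Data.List.Relation.Unary.All using (All)
open import Data.List.Relation.Unary.Linked using (Linked)
open import Data.List.Relation.Unary.Unique.Propositional using (Unique)
open import Data.Nat.Base
  using (ℕ; zero; suc; _+_; _*_; _∸_; _/_; _≤_; _<_; _≥_; _>_; ∣_-_∣; NonTrivial; nonTrivial⇒nonZero)
open import Data.Product.Base using (Σ-syntax; ∃; ∃₂; _×_; _,_)
open import Function.Bundles using (_⇔_)
open import Relation.Binary.Construct.Closure.ReflexiveTransitive using (Star)
open import Relation.Binary.PropositionalEquality.Core using (_≡_)
open import Relation.Nullary.Negation.Core using (¬_)

-- Exactly n elements of A satisfy P: some duplicate-free list of length n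
-- contains precisely the elements satisfying P.
HasCardinality : {A : Set} → (A → Set) → ℕ → Set
HasCardinality {A} P n =
  Σ[ xs ∈ List A ] Unique xs × (∀ x → x ∈ xs ⇔ P x) × length xs ≡ n

record Partition : Set where
  field
    parts      : List ℕ
    decreasing : Linked _≥_ parts
    positive   : All (_> 0) parts

open Partition public

-- The entry at a (zero-based) position, or 0 past the end of the list.
entry : List ℕ → ℕ → ℕ
entry []       _       = 0
entry (x ∷ _)  zero    = x
entry (_ ∷ xs) (suc n) = entry xs n

-- Zero-based: part p i is λ_{i+1}, and part p 0 = 0 for the empty partition.
part : Partition → ℕ → ℕ
part p = entry (parts p)

ℓ : Partition → ℕ
ℓ p = length (parts p)

-- Boxes are (row , column), both counted from 0.
Box : Set
Box = ℕ × ℕ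

Shape : Set₁
Shape = Box → Set

diagram : Partition → Shape
diagram p (i , j) = j < part p i

_⊆_ : Partition → Partition → Set
p ⊆ p′ = ∀ b → diagram p b → diagram p′ b

-- skew p m is the shape p / m.
skew : Partition → Partition → Shape
skew p m b = diagram p b × ¬ diagram m b

-- Sharing an edge (so not diagonal contact).
Adjacent : Box → Box → Set
Adjacent (i , j) (i′ , j′) = ∣ i - i′ ∣ + ∣ j - j′ ∣ ≡ 1

Connected : Shape → Set
Connected S = ∀ b c → S b → S c → Star (λ x y → S x × S y × Adjacent x y) b c

Contains2×2 : Shape → Set
Contains2×2 S =
  ∃₂ λ i j → S (i , j) × S (i , suc j) × S (suc i , j) × S (suc i , suc j)

-- p / m is a rim-hook of p with exactly t boxes.
IsRimHook : ℕ → Partition → Partition → Set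
IsRimHook t p m =
  m ⊆ p × Connected (skew p m) × ¬ Contains2×2 (skew p m) × HasCardinality (skew p m) t

IsCore : ℕ → Partition → Set
IsCore t p = ¬ ∃ λ m → IsRimHook t p m

FitsIn : ℕ → ℕ → Partition → Set
FitsIn r s p = ℓ p ≤ r × part p 0 ≤ s

-- Polynomials in q as coefficient lists, constant term first.
Poly : Set
Poly = List ℕ

-- Coefficient of q^n, 0 beyond the end of the list.
[q^_]_ : ℕ → Poly → ℕ
[q^ n ] p = entry p n

infixr 4 [q^_]_
infixl 6 _⊕_
infixl 7 _⊗_

_⊕_ : Poly → Poly → Poly
[]       ⊕ g        = g
(a ∷ f)  ⊕ []       = a ∷ f
(a ∷ f)  ⊕ (b ∷ g)  = (a + b) ∷ (f ⊕ g)

-- (a + q f) g = a g + q (f g)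
_⊗_ : Poly → Poly → Poly
[]      ⊗ g = []
(a ∷ f) ⊗ g = map (a *_) g ⊕ (0 ∷ (f ⊗ g))

-- ∏[< t ] f is f 0 ⊗ ⋯ ⊗ f (t - 1).
∏[<_] : ℕ → (ℕ → Poly) → Poly
∏[< t ] f = foldr _⊗_ (1 ∷ []) (map f (upTo t))

-- 1 + q + ⋯ + q^n
geometric : ℕ → Poly
geometric n = replicate (suc n) 1

-- ⌊ (r + s + t - 1 - i) / t ⌋; for i < t the subtractions never truncate.
nᵢ : (r s t : ℕ) .{{_ : NonTrivial t}} → ℕ → ℕ
nᵢ r s t i = ((r + s + t ∸ 1 ∸ i) / t) {{nonTrivial⇒nonZero t}}

{-# OPTIONS --safe #-}
module Submission where

-- Padding λ with zeros to r parts, its beads λᵢ + r - i (1 ≤ i ≤ r) form an r-element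
-- set of naturals determining λ, and λ fits in the r × s rectangle iff all beads are
-- below r + s.  Removing a t-rim hook moves one bead from x to an unoccupied x - t, so
-- λ is a t-core iff its set of beads is closed under subtracting t.  Such a set consists
-- of the cᵢ smallest numbers of each residue class i modulo t.  Of the numbers below
-- r + s, exactly nᵢ lie in class i, so the t-cores correspond to the tuples (cᵢ) with
-- cᵢ ≤ nᵢ and Σ cᵢ = r, and these are counted by the coefficient of q^r.

-- Why a bead moves: in a rim hook occupying rows a to b, consecutive rows share exactly one column.
-- Each row before b therefore shrinks to one box less than the next row of λ and takes over the
-- bead of that row. So the set of beads loses only the bead of row a and gains only the new bead of
-- row b, and the number of removed boxes telescopes to the difference of these two. The row
-- condition is isolated in `StripsHook`, which mediates in both directions: connectedness and the
-- absence of 2×2 blocks are used only to reach it, and are recovered from it when a hook is built.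
-- The equation Σ cᵢ = r is never computed: both sides turn out to be the cardinality of one and the
-- same set.

open import Defs
open import Data.Empty using (⊥; ⊥-elim)
open import Data.List.Base
  using (List; []; _∷_; _++_; length; map; foldr; filter; upTo; applyUpTo; downFrom)
open import Data.Nat.ListAction using (sum)
open import Data.List.Membership.Propositional using (_∈_)
open import Data.List.Membership.Propositional.Properties
  using (∈-map⁺; ∈-map⁻; ∈-++⁺ˡ; ∈-++⁺ʳ; ∈-++⁻; ∈-upTo⁺; ∈-upTo⁻; ∈-applyUpTo⁺; ∈-applyUpTo⁻;
         ∈-filter⁺; ∈-filter⁻; ∈-downFrom⁺; ∈-downFrom⁻)
open import Data.List.Membership.Propositional.Properties.WithK using (unique∧set⇒bag)
open import Data.List.Properties
  using (length-map; length-++; length-upTo; length-applyUpTo; map-applyUpTo; map-upTo)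
open import Data.List.Relation.Binary.BagAndSetEquality using (∼bag⇒↭)
open import Data.List.Relation.Binary.Permutation.Propositional.Properties using (↭-length)
open import Data.List.Relation.Binary.Pointwise using (Pointwise; []; _∷_; Pointwise-length)
open import Data.List.Relation.Unary.All as All using (All; []; _∷_)
open import Data.List.Relation.Unary.AllPairs using ([]; _∷_)
open import Data.List.Relation.Unary.Any using (here; there)
open import Data.List.Relation.Unary.Linked as Linked using (Linked; []; [-]; _∷_)
import Data.List.Relation.Unary.Linked.Properties as Linked
open import Data.List.Relation.Unary.Unique.Propositional using (Unique)
import Data.List.Relation.Unary.Unique.Propositional.Properties as Unique
open import Data.Nat.Base
open import Data.Nat.Divisibility using (n∣m*n)
open import Data.Nat.DivMod
open import Data.Nat.Properties
open import Data.Product.Base using (∃; ∃₂; _×_; _,_; proj₁; proj₂)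
open import Data.Sum.Base using (_⊎_; inj₁; inj₂)
open import Function.Base using (_∘_; id)
open import Function.Bundles using (_⇔_; mk⇔; Equivalence)
open import Function.Construct.Composition using (_⇔-∘_)
open import Function.Construct.Symmetry using (⇔-sym)
open import Relation.Binary.Construct.Closure.ReflexiveTransitive using (Star; ε; _◅_; _◅◅_; reverse)
open import Relation.Binary.Definitions using (tri<; tri≈; tri>)
open import Relation.Binary.PropositionalEquality
  using (_≡_; _≢_; refl; sym; trans; cong; cong₂; subst; module ≡-Reasoning)
open import Relation.Nullary.Decidable.Core using (yes; no)
open import Relation.Nullary.Negation.Core using (¬_)
open import Relation.Unary using (Decidable)

open Equivalence using (to; from)

-- Counting

module _ {A B : Set} where

  map-unique : (P : A → Set) (f : A → B) → (∀ {x y} → P x → P y → f x ≡ f y → x ≡ y) →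
    ∀ {xs} → (∀ {x} → x ∈ xs → P x) → Unique xs → Unique (map f xs)
  map-unique P f inj ps [] = []
  map-unique P f inj {x ∷ xs} ps (x∉ ∷ u) =
    All.tabulate fresh ∷ map-unique P f inj (ps ∘ there) u
    where
    fresh : ∀ {y} → y ∈ map f xs → f x ≢ y
    fresh y∈ fx≡y with z , z∈ , y≡fz ← ∈-map⁻ f y∈ =
      All.lookup x∉ z∈ (inj (ps (here refl)) (ps (there z∈)) (trans fx≡y y≡fz))

  -- Injectivity is asked for only on `P`, because `bead r p` is injective on the rows below `r` and
  -- `toPartition` on the valid tuples.
  card-image : ∀ {P : A → Set} {Q : B → Set} {n} (f : A → B) →
    (∀ {x y} → P x → P y → f x ≡ f y → x ≡ y) →
    (∀ {x} → P x → Q (f x)) → (∀ {y} → Q y → ∃ λ x → P x × f x ≡ y) →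
    HasCardinality P n → HasCardinality Q n
  card-image {P} {Q} f inj P⇒Q onto (xs , u , mem , len) =
    map f xs , map-unique P f inj (to (mem _)) u , (λ y → mk⇔ ⇒ ⇐) ,
    trans (length-map f xs) len
    where
    ⇒ : ∀ {y} → y ∈ map f xs → Q y
    ⇒ y∈ with z , z∈ , refl ← ∈-map⁻ f y∈ = P⇒Q (to (mem z) z∈)
    ⇐ : ∀ {y} → Q y → y ∈ map f xs
    ⇐ q with x , px , refl ← onto q = ∈-map⁺ f (from (mem x) px)

module _ {A : Set} {P Q : A → Set} where

  card-cong : ∀ {n} → (∀ {x} → P x ⇔ Q x) → HasCardinality P n → HasCardinality Q n
  card-cong P⇔Q (xs , u , mem , len) = xs , u , (λ x → P⇔Q ⇔-∘ mem x) , len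

  -- Duplicate-free lists with the same members are permutations of each other. Numerical
  -- identities, such as the size of a hook or the sum of a tuple, are obtained by counting one
  -- predicate in two ways.
  card-unique : ∀ {m n} → (∀ {x} → P x ⇔ Q x) →
    HasCardinality P m → HasCardinality Q n → m ≡ n
  card-unique P⇔Q (xs , u , mem , refl) (ys , v , mem′ , refl) =
    ↭-length (∼bag⇒↭ (unique∧set⇒bag u v λ {x} → ⇔-sym (mem′ x) ⇔-∘ (P⇔Q ⇔-∘ mem x)))

  card-⊎ : ∀ {m n} → (∀ {x} → P x → Q x → ⊥) →
    HasCardinality P m → HasCardinality Q n → HasCardinality (λ x → P x ⊎ Q x) (m + n)
  card-⊎ disj (xs , u , mem , refl) (ys , v , mem′ , refl) =
    xs ++ ys ,
    Unique.++⁺ u v (λ (x∈ , y∈) → disj (to (mem _) x∈) (to (mem′ _) y∈)) ,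
    (λ x → mk⇔ ⇒ ⇐) , length-++ xs
    where
    ⇒ : ∀ {x} → x ∈ xs ++ ys → P x ⊎ Q x
    ⇒ x∈ with ∈-++⁻ xs x∈
    ... | inj₁ l = inj₁ (to (mem _) l)
    ... | inj₂ r = inj₂ (to (mem′ _) r)
    ⇐ : ∀ {x} → P x ⊎ Q x → x ∈ xs ++ ys
    ⇐ (inj₁ p) = ∈-++⁺ˡ (from (mem _) p)
    ⇐ (inj₂ q) = ∈-++⁺ʳ xs (from (mem′ _) q)

card-< : ∀ n → HasCardinality (_< n) n
card-< n = upTo n , Unique.upTo⁺ n , (λ x → mk⇔ ∈-upTo⁻ ∈-upTo⁺) , length-upTo n

card-filter : ∀ {P : ℕ → Set} (P? : Decidable P) n →
  HasCardinality (λ x → x < n × P x) (length (filter P? (downFrom n)))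
card-filter P? n =
  filter P? (downFrom n) , Unique.filter⁺ P? (Unique.downFrom⁺ n) , (λ x → mk⇔ ⇒ ⇐) , refl
  where
  ⇒ : ∀ {x} → x ∈ filter P? (downFrom n) → _
  ⇒ x∈ with x∈′ , px ← ∈-filter⁻ P? {xs = downFrom n} x∈ = ∈-downFrom⁻ x∈′ , px
  ⇐ : ∀ {x} → _ → x ∈ filter P? (downFrom n)
  ⇐ (x<n , px) = ∈-filter⁺ P? (∈-downFrom⁺ x<n) px

Σ[<_] : ℕ → (ℕ → ℕ) → ℕ
Σ[< zero  ] f = 0
Σ[< suc n ] f = Σ[< n ] f + f n

Σ-suc : ∀ n f → Σ[< suc n ] f ≡ f 0 + Σ[< n ] (f ∘ suc)
Σ-suc zero    f = +-comm 0 (f 0)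
Σ-suc (suc n) f = trans (cong (_+ f (suc n)) (Σ-suc n f)) (+-assoc (f 0) _ _)

sum≡Σ-entry : ∀ xs → sum xs ≡ Σ[< length xs ] (entry xs)
sum≡Σ-entry []       = refl
sum≡Σ-entry (x ∷ xs) =
  trans (cong (x +_) (sum≡Σ-entry xs)) (sym (Σ-suc (length xs) (entry (x ∷ xs))))

Between : (lo hi : ℕ → ℕ) → Shape
Between lo hi (i , j) = lo i ≤ j × j < hi i

card-row : ∀ n lo hi → HasCardinality (λ (i , j) → i ≡ n × lo ≤ j × j < hi) (hi ∸ lo)
card-row n lo hi =
  applyUpTo cell (hi ∸ lo) ,
  Unique.applyUpTo⁺₁ cell (hi ∸ lo) (λ i<j _ eq → <⇒≢ i<j (+-cancelˡ-≡ lo _ _ (cong proj₂ eq))) ,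
  (λ b → mk⇔ ⇒ ⇐) , length-applyUpTo cell (hi ∸ lo)
  where
  cell : ℕ → Box
  cell k = n , lo + k
  ⇒ : ∀ {b} → b ∈ applyUpTo cell (hi ∸ lo) → proj₁ b ≡ n × lo ≤ proj₂ b × proj₂ b < hi
  ⇒ b∈ with k , k< , refl ← ∈-applyUpTo⁻ cell b∈ =
    refl , m≤m+n lo k ,
    subst (lo + k <_) (m+[n∸m]≡n (<⇒≤ (m∸n≢0⇒n<m {hi} {lo} (m<n⇒n≢0 k<)))) (+-monoʳ-< lo k<)
  ⇐ : ∀ {b} → proj₁ b ≡ n × lo ≤ proj₂ b × proj₂ b < hi → b ∈ applyUpTo cell (hi ∸ lo)
  ⇐ {_ , j} (refl , lo≤j , j<hi) =
    subst (λ x → (n , x) ∈ applyUpTo cell (hi ∸ lo)) (m+[n∸m]≡n lo≤j)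
      (∈-applyUpTo⁺ cell (∸-monoˡ-< j<hi lo≤j))

card-between : ∀ n lo hi →
  HasCardinality (λ b → proj₁ b < n × Between lo hi b) (Σ[< n ] (λ i → hi i ∸ lo i))
card-between zero    lo hi = [] , [] , (λ b → mk⇔ (λ ()) (λ ())) , refl
card-between (suc n) lo hi =
  card-cong (mk⇔ ⇒ ⇐)
    (card-⊎ (λ (i<n , _) (i≡n , _) → <⇒≢ i<n i≡n) (card-between n lo hi)
                                                    (card-row n (lo n) (hi n)))
  where
  Old New : Box → Set
  Old b = proj₁ b < n × Between lo hi b
  New b = proj₁ b ≡ n × lo n ≤ proj₂ b × proj₂ b < hi n
  ⇒ : ∀ {b} → Old b ⊎ New b → proj₁ b < suc n × Between lo hi b
  ⇒ (inj₁ (i<n , b))  = m<n⇒m<1+n i<n , b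
  ⇒ (inj₂ (refl , b)) = ≤-refl , b
  ⇐ : ∀ {b} → proj₁ b < suc n × Between lo hi b → Old b ⊎ New b
  ⇐ (s≤s i≤n , b) with m≤n⇒m<n∨m≡n i≤n
  ... | inj₁ i<n  = inj₁ (i<n , b)
  ... | inj₂ refl = inj₂ (refl , b)

-- Coefficients of products of geometric polynomials

entry-⊕ : ∀ f g n → entry (f ⊕ g) n ≡ entry f n + entry g n
entry-⊕ []      g       n       = refl
entry-⊕ (a ∷ f) []      n       = sym (+-identityʳ _)
entry-⊕ (a ∷ f) (b ∷ g) zero    = refl
entry-⊕ (a ∷ f) (b ∷ g) (suc n) = entry-⊕ f g n

entry-map-* : ∀ a g n → entry (map (a *_) g) n ≡ a * entry g n
entry-map-* a []      n       = sym (*-zeroʳ a)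
entry-map-* a (b ∷ g) zero    = refl
entry-map-* a (b ∷ g) (suc n) = entry-map-* a g n

entry-1∷-⊗ : ∀ f g n → entry ((1 ∷ f) ⊗ g) n ≡ entry g n + entry (0 ∷ (f ⊗ g)) n
entry-1∷-⊗ f g n =
  trans (entry-⊕ (map (1 *_) g) _ n)
        (cong (_+ entry (0 ∷ (f ⊗ g)) n) (trans (entry-map-* 1 g n) (*-identityˡ _)))

BoundedTuple : List ℕ → ℕ → List ℕ → Set
BoundedTuple ns r cs = Pointwise _≤_ cs ns × sum cs ≡ r

incHead : List ℕ → List ℕ
incHead []       = []
incHead (c ∷ cs) = suc c ∷ cs

card-0∷ : ∀ {n ns r k} → HasCardinality (BoundedTuple ns r) k →
  HasCardinality (λ cs → BoundedTuple (n ∷ ns) r cs × entry cs 0 ≡ 0) k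
card-0∷ = card-image (0 ∷_) (λ { _ _ refl → refl }) (λ (b , s) → (z≤n ∷ b , s) , refl)
  λ { ((_ ∷ b , s) , refl) → _ , (b , s) , refl }

card-incHead : ∀ {n ns r k} → HasCardinality (BoundedTuple (n ∷ ns) r) k →
  HasCardinality (λ cs → BoundedTuple (suc n ∷ ns) (suc r) cs × entry cs 0 ≢ 0) k
card-incHead = card-image incHead
  (λ { (_ ∷ _ , _) (_ ∷ _ , _) refl → refl })
  (λ { (c≤n ∷ b , s) → (s≤s c≤n ∷ b , cong suc s) , λ () })
  (λ { {zero ∷ _}  (_ , ≢0)                  → ⊥-elim (≢0 refl)
     ; {suc c ∷ _} ((s≤s c≤n ∷ b , s) , _) → c ∷ _ , (c≤n ∷ b , suc-injective s) , refl })

-- Induction on `n` through `geometric (suc n)` = 1 + q `geometric n`, which avoids convolution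
-- sums. The summand 1 accounts for the tuples with head 0, the summand with the factor q for those
-- with positive head, lowered by one.
card-boundedTuple-∷ : ∀ {ns g} →
  (∀ r → HasCardinality (BoundedTuple ns r) ([q^ r ] g)) →
  ∀ n r → HasCardinality (BoundedTuple (n ∷ ns) r) ([q^ r ] (geometric n ⊗ g))
card-boundedTuple-∷ {ns} {g} H zero r =
  subst (HasCardinality _) (sym coefficient)
    (card-cong (mk⇔ proj₁ (λ { b@(z≤n ∷ _ , _) → b , refl })) (card-0∷ (H r)))
  where
  0∷[]-entry : ∀ r → entry (0 ∷ []) r ≡ 0
  0∷[]-entry zero    = refl
  0∷[]-entry (suc _) = refl
  coefficient : entry ((1 ∷ []) ⊗ g) r ≡ entry g r
  coefficient = trans (entry-1∷-⊗ [] g r)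
    (trans (cong (entry g r +_) (0∷[]-entry r)) (+-identityʳ _))
card-boundedTuple-∷ {ns} {g} H (suc n) zero =
  subst (HasCardinality _) (sym (trans (entry-1∷-⊗ (geometric n) g 0) (+-identityʳ _)))
    (card-cong (mk⇔ proj₁ (λ b → b , head≡0 b)) (card-0∷ (H 0)))
  where
  head≡0 : ∀ {cs} → BoundedTuple (suc n ∷ ns) 0 cs → entry cs 0 ≡ 0
  head≡0 (_∷_ {x = zero} _ _ , s) = refl
card-boundedTuple-∷ {ns} {g} H (suc n) (suc r) =
  subst (HasCardinality _) (sym (entry-1∷-⊗ (geometric n) g (suc r)))
    (card-cong (mk⇔ (λ { (inj₁ (b , _)) → b ; (inj₂ (b , _)) → b }) split)
      (card-⊎ (λ (_ , ≡0) (_ , ≢0) → ≢0 ≡0)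
        (card-0∷ (H (suc r))) (card-incHead (card-boundedTuple-∷ {g = g} H n r))))
  where
  split : ∀ {cs} → BoundedTuple (suc n ∷ ns) (suc r) cs →
    (BoundedTuple (suc n ∷ ns) (suc r) cs × entry cs 0 ≡ 0) ⊎
    (BoundedTuple (suc n ∷ ns) (suc r) cs × entry cs 0 ≢ 0)
  split {cs} b with entry cs 0 ≟ 0
  ... | yes ≡0 = inj₁ (b , ≡0)
  ... | no  ≢0 = inj₂ (b , ≢0)

card-boundedTuple : ∀ ns r →
  HasCardinality (BoundedTuple ns r) ([q^ r ] foldr _⊗_ (1 ∷ []) (map geometric ns))
card-boundedTuple []       zero    =
  ([] ∷ []) , [] ∷ [] , (λ _ → mk⇔ (λ { (here refl) → [] , refl }) λ { ([] , _) → here refl }) , refl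
card-boundedTuple []       (suc r) = [] , [] , (λ _ → mk⇔ (λ ()) λ { ([] , ()) }) , refl
card-boundedTuple (n ∷ ns) r       =
  card-boundedTuple-∷ {g = foldr _⊗_ (1 ∷ []) (map geometric ns)} (card-boundedTuple ns) n r

-- Partitions and their beads

entry-antitone-suc : ∀ {xs} → Linked _≥_ xs → ∀ i → entry xs (suc i) ≤ entry xs i
entry-antitone-suc []          i       = z≤n
entry-antitone-suc [-]         i       = z≤n
entry-antitone-suc (x≥y ∷ l)   zero    = x≥y
entry-antitone-suc (x≥y ∷ l)   (suc i) = entry-antitone-suc l i

antitone : ∀ (f : ℕ → ℕ) → (∀ i → f (suc i) ≤ f i) → ∀ {i j} → i ≤ j → f j ≤ f i
antitone f step {i} i≤j = go (≤⇒≤′ i≤j)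
  where
  go : ∀ {j} → i ≤′ j → f j ≤ f i
  go ≤′-refl       = ≤-refl
  go (≤′-step i≤j) = ≤-trans (step _) (go i≤j)

part-antitone : ∀ p {i j} → i ≤ j → part p j ≤ part p i
part-antitone p = antitone (part p) (entry-antitone-suc (decreasing p))

entry-beyond : ∀ xs {i} → length xs ≤ i → entry xs i ≡ 0
entry-beyond []       _         = refl
entry-beyond (x ∷ xs) (s≤s l≤i) = entry-beyond xs l≤i

entry-positive⇒<length : ∀ xs {i j} → j < entry xs i → i < length xs
entry-positive⇒<length xs j< = ≰⇒> λ l≤i → n≮0 (subst (_ <_) (entry-beyond xs l≤i) j<)

entries≡⇒≡ : ∀ {xs ys} → All (_> 0) xs → All (_> 0) ys →
  (∀ i → entry xs i ≡ entry ys i) → xs ≡ ys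
entries≡⇒≡ []       []       eq = refl
entries≡⇒≡ []       (y ∷ _)  eq = ⊥-elim (<⇒≢ y (eq 0))
entries≡⇒≡ (x ∷ _)  []       eq = ⊥-elim (<⇒≢ x (sym (eq 0)))
entries≡⇒≡ (_ ∷ xs) (_ ∷ ys) eq = cong₂ _∷_ (eq 0) (entries≡⇒≡ xs ys (eq ∘ suc))

-- Cardinality counts records up to `≡`, so the proof fields must agree too; both are built from
-- `≤`, whose proofs are unique.
parts≡⇒≡ : ∀ {p p′} → parts p ≡ parts p′ → p ≡ p′
parts≡⇒≡ {p} {p′} refl =
  cong₂ (λ d q → record { parts = parts p ; decreasing = d ; positive = q })
    (Linked.irrelevant ≤-irrelevant (decreasing p) (decreasing p′))
    (All.irrelevant ≤-irrelevant (positive p) (positive p′))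

part≡⇒≡ : ∀ {p p′} → (∀ i → part p i ≡ part p′ i) → p ≡ p′
part≡⇒≡ {p} {p′} = parts≡⇒≡ ∘ entries≡⇒≡ (positive p) (positive p′)

-- For an antitone sequence nothing is lost by stopping at the first zero. The second argument
-- bounds the number of parts.
takePositive : (ℕ → ℕ) → ℕ → List ℕ
takePositive f zero    = []
takePositive f (suc n) with f 0
... | zero  = []
... | suc x = suc x ∷ takePositive (f ∘ suc) n

takePositive-decreasing : ∀ f → (∀ i → f (suc i) ≤ f i) → ∀ n → Linked _≥_ (takePositive f n)
takePositive-decreasing f anti zero    = []
takePositive-decreasing f anti (suc n) with f 0 in f0
... | zero  = []
... | suc x = cons n (takePositive-decreasing (f ∘ suc) (anti ∘ suc) n)
  where
  cons : ∀ n → Linked _≥_ (takePositive (f ∘ suc) n) → Linked _≥_ (suc x ∷ takePositive (f ∘ suc) n)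
  cons zero    l = [-]
  cons (suc n) l with f 1 in f1
  ... | zero  = [-]
  ... | suc y = subst (_≤ suc x) f1 (subst (f 1 ≤_) f0 (anti 0)) ∷ l

takePositive-positive : ∀ f n → All (_> 0) (takePositive f n)
takePositive-positive f zero    = []
takePositive-positive f (suc n) with f 0
... | zero  = []
... | suc x = z<s ∷ takePositive-positive (f ∘ suc) n

takePositive-length : ∀ f n → length (takePositive f n) ≤ n
takePositive-length f zero    = z≤n
takePositive-length f (suc n) with f 0
... | zero  = z≤n
... | suc x = s≤s (takePositive-length (f ∘ suc) n)

entry-takePositive : ∀ f → (∀ i → f (suc i) ≤ f i) → ∀ n → (∀ {i} → n ≤ i → f i ≡ 0) →
  ∀ i → entry (takePositive f n) i ≡ f i
entry-takePositive f anti zero    vanish i = sym (vanish z≤n)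
entry-takePositive f anti (suc n) vanish i with f 0 in f0
entry-takePositive f anti (suc n) vanish i       | zero =
  sym (n≤0⇒n≡0 (subst (f i ≤_) f0 (antitone f anti z≤n)))
entry-takePositive f anti (suc n) vanish zero    | suc x = sym f0
entry-takePositive f anti (suc n) vanish (suc i) | suc x =
  entry-takePositive (f ∘ suc) (anti ∘ suc) n (vanish ∘ s≤s) i

fromSequence : (f : ℕ → ℕ) → (∀ i → f (suc i) ≤ f i) → ℕ → Partition
fromSequence f anti n = record
  { parts      = takePositive f n
  ; decreasing = takePositive-decreasing f anti n
  ; positive   = takePositive-positive f n
  }

-- The first-column hook lengths of p, once p is padded with zeros to r parts;
-- meaningful for i < r only.
bead : ℕ → Partition → ℕ → ℕ
bead r p i = part p i + (r ∸ suc i)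

IsBead : ℕ → Partition → ℕ → Set
IsBead r p y = ∃ λ i → i < r × bead r p i ≡ y

isBead? : ∀ r p → Decidable (IsBead r p)
isBead? r p y = anyUpTo? (λ i → bead r p i ≟ y) r

bead-antitone : ∀ r p {i j} → i ≤ j → bead r p j ≤ bead r p i
bead-antitone r p i≤j = +-mono-≤ (part-antitone p i≤j) (∸-monoʳ-≤ r (s≤s i≤j))

bead-strict : ∀ r p {i j} → i < j → j < r → bead r p j < bead r p i
bead-strict r p {i} {j} i<j j<r =
  +-mono-≤-< (part-antitone p (<⇒≤ i<j)) (∸-monoʳ-< (s≤s i<j) j<r)

bead-injective : ∀ r p {i j} → i < r → j < r → bead r p i ≡ bead r p j → i ≡ j
bead-injective r p {i} {j} i<r j<r eq with <-cmp i j
... | tri< i<j _ _ = ⊥-elim (<⇒≢ (bead-strict r p i<j j<r) (sym eq))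
... | tri≈ _ i≡j _ = i≡j
... | tri> _ _ j<i = ⊥-elim (<⇒≢ (bead-strict r p j<i i<r) eq)

card-IsBead : ∀ r p → HasCardinality (IsBead r p) r
card-IsBead r p = card-image (bead r p) (bead-injective r p)
  (λ {i} i<r → i , i<r , refl) id (card-< r)

-- A bead of p′ at most as large as the i-th bead of p cannot come before it once
-- the first i beads agree, so the i-th beads bound each other.
bead-unique : ∀ r p p′ → (∀ {y} → IsBead r p y ⇔ IsBead r p′ y) →
  ∀ n {i} → i < n → i < r → bead r p i ≡ bead r p′ i
bead-unique r p p′ same (suc n) {i} i<1+n i<r =
  ≤-antisym (bound p p′ (to same) (λ j<i → bead-unique r p p′ same n (<-≤-trans j<i i≤n)))
            (bound p′ p (from same) (λ j<i → sym ∘ bead-unique r p p′ same n (<-≤-trans j<i i≤n)))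
  where
  i≤n : i ≤ n
  i≤n = s≤s⁻¹ i<1+n
  bound : ∀ p p′ → (∀ {y} → IsBead r p y → IsBead r p′ y) →
    (∀ {j} → j < i → j < r → bead r p j ≡ bead r p′ j) → bead r p i ≤ bead r p′ i
  bound p p′ ⊆ agree with ⊆ (i , i<r , refl)
  ... | j , j<r , eq with j <? i
  ...   | yes j<i = ⊥-elim (<⇒≢ (bead-strict r p j<i i<r) (sym (trans (agree j<i j<r) eq)))
  ...   | no  j≮i = subst (_≤ bead r p′ i) eq (bead-antitone r p′ (≮⇒≥ j≮i))

beads-determine : ∀ r p p′ → ℓ p ≤ r → ℓ p′ ≤ r →
  (∀ {y} → IsBead r p y ⇔ IsBead r p′ y) → p ≡ p′
beads-determine r p p′ ℓ≤r ℓ′≤r same = part≡⇒≡ parts≡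
  where
  parts≡ : ∀ i → part p i ≡ part p′ i
  parts≡ i with i <? r
  ... | yes i<r = +-cancelʳ-≡ (r ∸ suc i) _ _ (bead-unique r p p′ same (suc i) ≤-refl i<r)
  ... | no  i≮r = trans (entry-beyond (parts p) (≤-trans ℓ≤r (≮⇒≥ i≮r)))
                   (sym (entry-beyond (parts p′) (≤-trans ℓ′≤r (≮⇒≥ i≮r))))

entry-strict : ∀ {xs} → Linked _>_ xs → ∀ {i} → suc i < length xs → entry xs (suc i) < entry xs i
entry-strict (x>y ∷ l) {zero}  _        = x>y
entry-strict (x>y ∷ l) {suc i} (s≤s i<) = entry-strict l i<
entry-strict [-]       {zero}  (s≤s ())
entry-strict [-]       {suc i} (s≤s ())

-- The entry is followed by `length xs ∸ suc i` distinct smaller naturals. Hence the subtraction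
-- that turns beads back into parts is exact.
length-∸-≤-entry : ∀ {xs} → Linked _>_ xs → ∀ i → length xs ∸ suc i ≤ entry xs i
length-∸-≤-entry []        i       = z≤n
length-∸-≤-entry [-]       zero    = z≤n
length-∸-≤-entry [-]       (suc i) = z≤n
length-∸-≤-entry (x>y ∷ l) zero    = ≤-trans (s≤s (length-∸-≤-entry l 0)) x>y
length-∸-≤-entry (x>y ∷ l) (suc i) = length-∸-≤-entry l i

∈⇒entry : ∀ {x xs} → x ∈ xs → ∃ λ i → i < length xs × entry xs i ≡ x
∈⇒entry (here refl) = 0 , z<s , refl
∈⇒entry (there x∈) with i , i< , eq ← ∈⇒entry x∈ = suc i , s<s i< , eq

entry-∈ : ∀ xs {i} → i < length xs → entry xs i ∈ xs
entry-∈ (x ∷ xs) {zero}  _         = here refl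
entry-∈ (x ∷ xs) {suc i} (s≤s i<) = there (entry-∈ xs i<)

module FromBeads {xs : List ℕ} (xs↘ : Linked _>_ xs) where

  private
    r = length xs

    f : ℕ → ℕ
    f i = entry xs i ∸ (r ∸ suc i)

    -- The subtracted staircase falls by one from each row to the next; the strict decrease of the
    -- entries makes up for it.
    f-antitone : ∀ i → f (suc i) ≤ f i
    f-antitone i with suc i <? r
    ... | yes i+1<r = begin
      entry xs (suc i) ∸ (r ∸ suc (suc i))           ≤⟨ ∸-monoˡ-≤ (r ∸ suc (suc i)) (<⇒≤pred (entry-strict xs↘ i+1<r)) ⟩
      pred (entry xs i) ∸ (r ∸ suc (suc i))          ≡⟨ ∸-+-assoc (entry xs i) 1 _ ⟩
      entry xs i ∸ suc (r ∸ suc (suc i))             ≡⟨ cong (entry xs i ∸_) (sym (+-∸-assoc 1 i+1<r)) ⟩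
      entry xs i ∸ (r ∸ suc i)                       ∎
      where open ≤-Reasoning
    ... | no i+1≮r = ≤-trans (m∸n≤m _ (r ∸ suc (suc i)))
      (≤-trans (≤-reflexive (entry-beyond xs (≮⇒≥ i+1≮r))) z≤n)

  fromBeads : Partition
  fromBeads = fromSequence f f-antitone r

  fromBeads-ℓ : ℓ fromBeads ≤ r
  fromBeads-ℓ = takePositive-length f r

  bead-fromBeads : ∀ i → bead r fromBeads i ≡ entry xs i
  bead-fromBeads i =
    trans (cong (_+ (r ∸ suc i)) (entry-takePositive f f-antitone r vanish i))
          (m∸n+n≡m (length-∸-≤-entry xs↘ i))
    where
    vanish : ∀ {i} → r ≤ i → f i ≡ 0
    vanish {i} r≤i = trans (cong (_∸ (r ∸ suc i)) (entry-beyond xs r≤i)) (0∸n≡0 (r ∸ suc i))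

  isBead-fromBeads : ∀ {y} → IsBead r fromBeads y ⇔ y ∈ xs
  isBead-fromBeads = mk⇔ ⇒ ⇐
    where
    ⇒ : ∀ {y} → IsBead r fromBeads y → y ∈ xs
    ⇒ (i , i<r , refl) = subst (_∈ xs) (sym (bead-fromBeads i)) (entry-∈ xs i<r)
    ⇐ : ∀ {y} → y ∈ xs → IsBead r fromBeads y
    ⇐ y∈ with i , i<r , refl ← ∈⇒entry y∈ = i , i<r , bead-fromBeads i

-- Rim hooks and beads

-- Rows a, …, b (counted from 0) of λ lose a rim hook, leaving μ: in all but the
-- last of these rows, what remains is one box short of the next row of λ.
record StripsHook (λᵣ μᵣ : ℕ → ℕ) (a b : ℕ) : Set where
  field
    above  : ∀ {i} → i < a → μᵣ i ≡ λᵣ i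
    inside : ∀ {i} → a ≤ i → i < b → suc (μᵣ i) ≡ λᵣ (suc i)
    last   : μᵣ b < λᵣ b
    below  : ∀ {i} → b < i → μᵣ i ≡ λᵣ i

module HookSize {λᵣ μᵣ : ℕ → ℕ} (μ≤λ : ∀ i → μᵣ i ≤ λᵣ i) {a m : ℕ}
  (hook : StripsHook λᵣ μᵣ a (a + m)) where

  open StripsHook hook
  open ≡-Reasoning

  removed : ℕ → ℕ
  removed i = λᵣ i ∸ μᵣ i

  private
    Σ-above : ∀ n → n ≤ a → Σ[< n ] removed ≡ 0
    Σ-above zero    _   = refl
    Σ-above (suc n) n<a = cong₂ _+_ (Σ-above n (<⇒≤ n<a)) (m≤n⇒m∸n≡0 (≤-reflexive (sym (above n<a))))

    -- By `inside`, row i loses λᵢ - λᵢ₊₁ + 1 boxes, so the sum telescopes. The last row length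
    -- stays on the left to keep subtraction out of the equation.
    Σ-inside : ∀ k → k ≤ m → Σ[< a + k ] removed + λᵣ (a + k) ≡ λᵣ a + k
    Σ-inside zero    _   rewrite +-identityʳ a | Σ-above a ≤-refl = sym (+-identityʳ _)
    Σ-inside (suc k) k<m rewrite +-suc a k = begin
      Σk + removed (a + k) + λᵣ (suc (a + k))    ≡⟨ cong (Σk + removed (a + k) +_) (sym (inside (m≤m+n a k) (+-monoʳ-< a k<m))) ⟩
      Σk + removed (a + k) + suc (μᵣ (a + k))    ≡⟨ +-suc _ _ ⟩
      suc (Σk + removed (a + k) + μᵣ (a + k))    ≡⟨ cong suc (+-assoc Σk _ _) ⟩
      suc (Σk + (removed (a + k) + μᵣ (a + k)))  ≡⟨ cong (λ x → suc (Σk + x)) (m∸n+n≡m (μ≤λ (a + k))) ⟩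
      suc (Σk + λᵣ (a + k))                      ≡⟨ cong suc (Σ-inside k (<⇒≤ k<m)) ⟩
      suc (λᵣ a + k)                             ≡⟨ sym (+-suc (λᵣ a) k) ⟩
      λᵣ a + suc k                               ∎
      where Σk = Σ[< a + k ] removed

    Σ-below : ∀ k → Σ[< suc (a + m) + k ] removed + μᵣ (a + m) ≡ λᵣ a + m
    Σ-below zero rewrite +-identityʳ (a + m) = begin
      Σm + removed (a + m) + μᵣ (a + m)    ≡⟨ +-assoc Σm _ _ ⟩
      Σm + (removed (a + m) + μᵣ (a + m))  ≡⟨ cong (Σm +_) (m∸n+n≡m (μ≤λ (a + m))) ⟩
      Σm + λᵣ (a + m)                      ≡⟨ Σ-inside m ≤-refl ⟩
      λᵣ a + m                             ∎
      where Σm = Σ[< a + m ] removed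
    Σ-below (suc k) rewrite +-suc (a + m) k
      | m≤n⇒m∸n≡0 (≤-reflexive (sym (below {suc (a + m + k)} (s≤s (m≤m+n (a + m) k)))))
      | +-identityʳ (Σ[< suc (a + m) + k ] removed) = Σ-below k

  hook-size : ∀ {r} → a + m < r → Σ[< r ] removed + μᵣ (a + m) ≡ λᵣ a + m
  hook-size {r} b<r =
    subst (λ n → Σ[< n ] removed + μᵣ (a + m) ≡ λᵣ a + m) (m+[n∸m]≡n b<r)
      (Σ-below (r ∸ suc (a + m)))

-- The distance of the bead move: the vanished bead of row `a` exceeds the new bead of row `b` by
-- exactly the number of removed boxes.
hook-bead : ∀ {λᵣ μᵣ} → (∀ i → μᵣ i ≤ λᵣ i) → ∀ {a b r} → a ≤ b → b < r → StripsHook λᵣ μᵣ a b →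
  Σ[< r ] (λ i → λᵣ i ∸ μᵣ i) + (μᵣ b + (r ∸ suc b)) ≡ λᵣ a + (r ∸ suc a)
hook-bead {λᵣ} {μᵣ} μ≤λ {a} {b} {r} a≤b b<r hook with m , refl ← m≤n⇒∃[o]m+o≡n a≤b = begin
  S + (μᵣ (a + m) + (r ∸ suc (a + m)))  ≡⟨ sym (+-assoc S _ _) ⟩
  S + μᵣ (a + m) + (r ∸ suc (a + m))    ≡⟨ cong (_+ (r ∸ suc (a + m))) (HookSize.hook-size μ≤λ hook b<r) ⟩
  λᵣ a + m + (r ∸ suc (a + m))          ≡⟨ +-assoc (λᵣ a) m _ ⟩
  λᵣ a + (m + (r ∸ suc (a + m)))        ≡⟨ cong (λ x → λᵣ a + (m + x)) (sym (∸-+-assoc r (suc a) m)) ⟩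
  λᵣ a + (m + (r ∸ suc a ∸ m))          ≡⟨ cong (λᵣ a +_) (m+[n∸m]≡n (m+n≤o⇒n≤o∸m (suc a) b<r)) ⟩
  λᵣ a + (r ∸ suc a)                    ∎
  where
  open ≡-Reasoning
  S = Σ[< r ] (λ i → λᵣ i ∸ μᵣ i)
  m+n≤o⇒n≤o∸m : ∀ m {n o} → m + n ≤ o → n ≤ o ∸ m
  m+n≤o⇒n≤o∸m m {n} {o} m+n≤o = subst (_≤ o ∸ m) (m+n∸m≡n m n) (∸-monoˡ-≤ m m+n≤o)

skew⇔between : ∀ {r} p m → ℓ p ≤ r → ∀ {b} →
  (proj₁ b < r × Between (part m) (part p) b) ⇔ skew p m b
skew⇔between p m ℓ≤r =
  mk⇔ (λ (_ , μ≤j , j<λ) → j<λ , ≤⇒≯ μ≤j)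
      (λ (j<λ , j≮μ) → <-≤-trans (entry-positive⇒<length (parts p) j<λ) ℓ≤r , ≮⇒≥ j≮μ , j<λ)

card-skew : ∀ {r} p m → ℓ p ≤ r → HasCardinality (skew p m) (Σ[< r ] (λ i → part p i ∸ part m i))
card-skew {r} p m ℓ≤r = card-cong (skew⇔between p m ℓ≤r) (card-between r (part m) (part p))

⊆⇒part≤ : ∀ {m p} → m ⊆ p → ∀ i → part m i ≤ part p i
⊆⇒part≤ {m} {p} m⊆p i = ≮⇒≥ λ λ<μ → n≮n _ (m⊆p (i , part p i) λ<μ)

module _ {P : ℕ → Set} (P? : Decidable P) where

  least : ∀ {n} → P n → ∃ λ k → k ≤ n × P k × (∀ {i} → i < k → ¬ P i)
  least {n} pn with go n
    where
    go : ∀ n → (∃ λ k → k < n × P k × (∀ {i} → i < k → ¬ P i)) ⊎ (∀ {i} → i < n → ¬ P i)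
    go zero    = inj₂ λ ()
    go (suc n) with go n
    ... | inj₁ (k , k<n , rest) = inj₁ (k , m<n⇒m<1+n k<n , rest)
    ... | inj₂ none with P? n
    ...   | yes pn = inj₁ (n , ≤-refl , pn , none)
    ...   | no ¬pn = inj₂ λ i<1+n pi → ¬pn (subst P (i≡n i<1+n pi) pi)
      where
      i≡n : ∀ {i} → i < suc n → P i → i ≡ n
      i≡n (s≤s i≤n) pi with m≤n⇒m<n∨m≡n i≤n
      ... | inj₁ i<n = ⊥-elim (none i<n pi)
      ... | inj₂ eq  = eq
  ... | inj₁ (k , k<n , rest) = k , <⇒≤ k<n , rest
  ... | inj₂ none             = n , ≤-refl , pn , none

  greatest : ∀ {n a} → a < n → P a → ∃ λ k → a ≤ k × k < n × P k × (∀ {i} → k < i → i < n → ¬ P i)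
  greatest {suc n} (s≤s a≤n) pa with P? n
  ... | yes pn = n , a≤n , ≤-refl , pn , λ n<i i≤n → ⊥-elim (<⇒≱ n<i (s≤s⁻¹ i≤n))
  ... | no ¬pn with m≤n⇒m<n∨m≡n a≤n
  ...   | inj₂ refl = ⊥-elim (¬pn pa)
  ...   | inj₁ a<n with k , a≤k , k<n , pk , none ← greatest a<n pa =
    k , a≤k , m<n⇒m<1+n k<n , pk , none′
    where
    none′ : ∀ {i} → k < i → i < suc n → ¬ P i
    none′ k<i (s≤s i≤n) pi with m≤n⇒m<n∨m≡n i≤n
    ... | inj₁ i<n  = none k<i i<n pi
    ... | inj₂ refl = ¬pn pi

-- Closed under subtracting t: all beads on the t-abacus are pushed up.
Flush : ℕ → (ℕ → Set) → Set
Flush t B = ∀ y → B (t + y) → B y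

module HookRows {r} (p m : Partition) (ℓ≤r : ℓ p ≤ r) (m⊆p : m ⊆ p)
  (connected : Connected (skew p m)) (no2×2 : ¬ Contains2×2 (skew p m)) where

  private
    μ≤λ = ⊆⇒part≤ {m} {p} m⊆p

    Step : Box → Box → Set
    Step b c = skew p m b × skew p m c × Adjacent b c

    -- If the rows i and i + 1 of the skew shape share no column, then no path
    -- leaves the rows up to i.
    touching : ∀ {i a b} → a ≤ i → i < b →
      part m a < part p a → part m b < part p b → part m i < part p (suc i)
    touching {i} {a} {b} a≤i i<b μa<λa μb<λb =
      ≰⇒> λ λ≤μ → <⇒≱ i<b (stays λ≤μ a≤i
        (connected (a , part m a) (b , part m b) (μa<λa , n≮n _) (μb<λb , n≮n _)))
      where
      stays : part p (suc i) ≤ part m i → ∀ {b c} → proj₁ b ≤ i → Star Step b c → proj₁ c ≤ i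
      stays λ≤μ b≤i ε = b≤i
      stays λ≤μ {x , y} b≤i (_◅_ {j = x′ , y′} ((_ , y≮μ) , (y′<λ , _) , adj) rest) =
        stays λ≤μ x′≤i rest
        where
        x′≤i : x′ ≤ i
        x′≤i = ≮⇒≥ λ i<x′ → crossing i<x′
          where
          crossing : i < x′ → ⊥
          crossing i<x′ with m≤n⇒∃[o]m+o≡n (≤-trans b≤i (<⇒≤ i<x′))
          ... | zero , refl = <⇒≱ i<x′ (subst (_≤ i) (sym (+-identityʳ x)) b≤i)
          -- The change of row uses up the whole distance 1, so the step is vertical. Its column is
          -- at least row `i` of `m`, yet inside row `suc i` of `p`, against the assumption that
          -- these rows share no column.
          ... | suc d , refl = <⇒≱ y<μi (≤-trans (part-antitone m b≤i) (≮⇒≥ y≮μ))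
            where
            adj′ : suc d + ∣ y - y′ ∣ ≡ 1
            adj′ = trans (cong (_+ ∣ y - y′ ∣) (sym (∣m-m+n∣≡n x (suc d)))) adj
            y≡y′ : y ≡ y′
            y≡y′ = ∣m-n∣≡0⇒m≡n (m+n≡0⇒n≡0 d (suc-injective adj′))
            y<μi : y < part m i
            y<μi = <-≤-trans (subst (_< part p (x + suc d)) (sym y≡y′) y′<λ)
                     (≤-trans (part-antitone p i<x′) λ≤μ)

  -- Take for `a` and `b` the first and the last row that loses a box. Between them connectedness
  -- makes neighbouring rows share at least one column, and the absence of 2×2 blocks at most one;
  -- together this is `inside`.
  rows : ∀ {c} → skew p m c →
    ∃₂ λ a b → a ≤ b × b < r × StripsHook (part p) (part m) a b
  rows {i , j} (j<λ , j≮μ)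
    with ≤-<-trans (≮⇒≥ j≮μ) j<λ
  ... | μi<λi
    with least (λ i → part m i <? part p i) μi<λi
  ... | a , a≤i , μa<λa , first
    with greatest (λ i → part m i <? part p i) (row<r (≤-<-trans z≤n μa<λa)) μa<λa
    where
    row<r : ∀ {i} → 0 < part p i → i < r
    row<r 0<λ = <-≤-trans (entry-positive⇒<length (parts p) 0<λ) ℓ≤r
  ... | b , a≤b , b<r , μb<λb , final = a , b , a≤b , b<r , record
    { above  = λ i<a → ≤-antisym (μ≤λ _) (≮⇒≥ (first i<a))
    ; inside = λ a≤i i<b → ≤-antisym (touching a≤i i<b μa<λa μb<λb) (thin _)
    ; last   = μb<λb
    ; below  = below
    }
    where
    below : ∀ {i} → b < i → part m i ≡ part p i
    below {i} b<i with i <? r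
    ... | yes i<r = ≤-antisym (μ≤λ i) (≮⇒≥ (final b<i i<r))
    ... | no  i≮r = ≤-antisym (μ≤λ i)
      (subst (_≤ part m i) (sym (entry-beyond (parts p) (≤-trans ℓ≤r (≮⇒≥ i≮r)))) z≤n)
    thin : ∀ i → part p (suc i) ≤ suc (part m i)
    thin i = ≮⇒≥ λ μ+1<λ → no2×2
      (i , part m i , (<-≤-trans (<-trans (n<1+n _) μ+1<λ) (part-antitone p (n≤1+n i)) , n≮n _) ,
                      (<-≤-trans μ+1<λ (part-antitone p (n≤1+n i)) , ≤⇒≯ (n≤1+n _)) ,
                      (<-trans (n<1+n _) μ+1<λ , ≤⇒≯ (part-antitone m (n≤1+n i))) ,
                      (μ+1<λ , ≤⇒≯ (≤-trans (part-antitone m (n≤1+n i)) (n≤1+n _))))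

flush⇒core : ∀ {r t} p → ℓ p ≤ r → 0 < t → Flush t (IsBead r p) → IsCore t p
-- Positivity of `t` excludes an empty list of boxes; the box `c` is what locates the hook.
flush⇒core {r} {t@(suc _)} p ℓ≤r _ flush (m , m⊆p , conn , no2×2 , card@(c ∷ _ , _ , mem , _))
  with a , b , a≤b , b<r , hook ← HookRows.rows p m ℓ≤r m⊆p conn no2×2 (to (mem c) (here refl)) =
  gap (flush y (a , <-≤-trans (s≤s a≤b) b<r , sym t+y≡bead))
  where
  open StripsHook hook
  y : ℕ
  y = part m b + (r ∸ suc b)
  t+y≡bead : t + y ≡ bead r p a
  t+y≡bead = trans (cong (_+ y) (card-unique (mk⇔ id id) card (card-skew p m ℓ≤r)))
                   (hook-bead (⊆⇒part≤ {m} {p} m⊆p) a≤b b<r hook)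
  -- The new bead `y` lies strictly below the beads of all rows up to `b` and strictly above those
  -- of all later rows, so it was unoccupied, although flushness puts a bead there.
  gap : ¬ IsBead r p y
  gap (i , i<r , eq) with i ≤? b
  ... | yes i≤b = <⇒≢ (<-≤-trans (+-monoˡ-< (r ∸ suc b) last) (bead-antitone r p i≤b)) (sym eq)
  ... | no  i≰b = <⇒≢ (+-mono-≤-< (subst (_≤ part m b) (below (≰⇒> i≰b)) (part-antitone m (<⇒≤ (≰⇒> i≰b))))
                                   (∸-monoʳ-< (s≤s (≰⇒> i≰b)) i<r)) eq

-- Building a rim hook on prescribed rows

strip : (a b v : ℕ) → (ℕ → ℕ) → ℕ → ℕ
strip a b v f i with i <? a | <-cmp i b
... | yes _ | _           = f i
... | no  _ | tri< _ _ _  = pred (f (suc i))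
... | no  _ | tri≈ _ _ _  = v
... | no  _ | tri> _ _ _  = f i

module Strip {a b v : ℕ} {f : ℕ → ℕ} (f-antitone : ∀ i → f (suc i) ≤ f i) (a≤b : a ≤ b)
  (v<fb : v < f b) (fb+1≤v : f (suc b) ≤ v) where

  stripped : ℕ → ℕ
  stripped = strip a b v f

  private
    f≥ : ∀ {i j} → i ≤ j → f j ≤ f i
    f≥ = antitone f f-antitone

    0<f : ∀ {i} → i ≤ b → 0 < f i
    0<f i≤b = ≤-<-trans z≤n (<-≤-trans v<fb (f≥ i≤b))

    suc-pred-f : ∀ {i} → i ≤ b → suc (pred (f i)) ≡ f i
    suc-pred-f {i} i≤b = suc-pred (f i) {{>-nonZero (0<f i≤b)}}

  at-end : stripped b ≡ v
  at-end with b <? a | <-cmp b b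
  ... | yes b<a | _          = ⊥-elim (<⇒≱ b<a a≤b)
  ... | no  _   | tri< _ ≢ _ = ⊥-elim (≢ refl)
  ... | no  _   | tri≈ _ _ _ = refl
  ... | no  _   | tri> _ ≢ _ = ⊥-elim (≢ refl)

  strip-hook : StripsHook f stripped a b
  strip-hook = record
    { above = above ; inside = inside ; last = subst (_< f b) (sym at-end) v<fb ; below = below }
    where
    above : ∀ {i} → i < a → stripped i ≡ f i
    above {i} i<a with i <? a
    ... | yes _   = refl
    ... | no  i≮a = ⊥-elim (i≮a i<a)
    inside : ∀ {i} → a ≤ i → i < b → suc (stripped i) ≡ f (suc i)
    inside {i} a≤i i<b with i <? a | <-cmp i b
    ... | yes i<a | _            = ⊥-elim (<⇒≱ i<a a≤i)
    ... | no  _   | tri< _ _ _   = suc-pred-f i<b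
    ... | no  _   | tri≈ i≮b _ _ = ⊥-elim (i≮b i<b)
    ... | no  _   | tri> i≮b _ _ = ⊥-elim (i≮b i<b)
    below : ∀ {i} → b < i → stripped i ≡ f i
    below {i} b<i with i <? a | <-cmp i b
    ... | yes _ | _            = refl
    ... | no  _ | tri< _ _ i≯b = ⊥-elim (i≯b b<i)
    ... | no  _ | tri≈ _ _ i≯b = ⊥-elim (i≯b b<i)
    ... | no  _ | tri> _ _ _   = refl

  open StripsHook strip-hook public

  stripped≤ : ∀ i → stripped i ≤ f i
  stripped≤ i with i <? a | <-cmp i b
  ... | yes _ | _             = ≤-refl
  ... | no  _ | tri< _ _ _    = ≤-trans pred[n]≤n (f-antitone i)
  ... | no  _ | tri≈ _ refl _ = <⇒≤ v<fb
  ... | no  _ | tri> _ _ _    = ≤-refl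

  stripped-antitone : ∀ i → stripped (suc i) ≤ stripped i
  stripped-antitone i with i <? a
  ... | yes i<a = ≤-trans (stripped≤ (suc i)) (f-antitone i)
  ... | no  i≮a with <-cmp i b
  ...   | tri≈ _ refl _ = ≤-trans (≤-reflexive (below ≤-refl)) fb+1≤v
  ...   | tri> _ _ b<i  = ≤-trans (stripped≤ (suc i)) (f-antitone i)
  ...   | tri< i<b _ _ with m≤n⇒m<n∨m≡n i<b
  ...     | inj₂ refl  = ≤-trans (≤-reflexive at-end) (<⇒≤pred v<fb)
  ...     | inj₁ i+1<b = <⇒≤pred (≤-trans (≤-reflexive (inside (m≤n⇒m≤1+n (≮⇒≥ i≮a)) i+1<b)) (f-antitone (suc i)))

-- The diagonal pair of boxes already gives the contradiction: together they would require row
-- `suc i` of `p` to exceed row `i` of `m` by at least two.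
hook⇒no2×2 : ∀ p m {a b} → StripsHook (part p) (part m) a b → ¬ Contains2×2 (skew p m)
hook⇒no2×2 p m {a} {b} hook (i , j , (j<λi , j≮μi) , _ , _ , (j+1<λ , j+1≮μ)) with i <? a | i <? b
... | yes i<a | _ = j≮μi (subst (j <_) (sym (StripsHook.above hook i<a)) j<λi)
... | no i≮a | yes i<b = j≮μi (s≤s⁻¹ (subst (suc j <_) (sym (StripsHook.inside hook (≮⇒≥ i≮a) i<b)) j+1<λ))
... | no i≮a | no i≮b = j+1≮μ (subst (suc j <_) (sym (StripsHook.below hook (s≤s (≮⇒≥ i≮b)))) j+1<λ)

module HookConnected (p m : Partition) {a b} (hook : StripsHook (part p) (part m) a b) where

  open StripsHook hook

  private
    Step : Box → Box → Set
    Step c d = skew p m c × skew p m d × Adjacent c d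

    ∣1+n-n∣≡1 : ∀ n → ∣ suc n - n ∣ ≡ 1
    ∣1+n-n∣≡1 zero    = refl
    ∣1+n-n∣≡1 (suc n) = ∣1+n-n∣≡1 n

    ∣n-1+n∣≡1 : ∀ n → ∣ n - suc n ∣ ≡ 1
    ∣n-1+n∣≡1 n = trans (∣-∣-comm n (suc n)) (∣1+n-n∣≡1 n)

    step-sym : ∀ {c d} → Step c d → Step d c
    step-sym {x , y} {x′ , y′} (sc , sd , adj) =
      sd , sc , trans (cong₂ _+_ (∣-∣-comm x′ x) (∣-∣-comm y′ y)) adj

    walkLeft : ∀ {i} k → part m i + k < part p i → Star Step (i , part m i + k) (i , part m i)
    walkLeft {i} zero    _ = subst (λ j → Star Step (i , j) (i , part m i)) (sym (+-identityʳ _)) ε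
    walkLeft {i} (suc k) lt =
      ((lt , ≤⇒≯ (m≤m+n _ (suc k))) , (lt′ , ≤⇒≯ (m≤m+n _ k)) , adj) ◅ walkLeft k lt′
      where
      lt′ : part m i + k < part p i
      lt′ = <-trans (+-monoʳ-< (part m i) (n<1+n k)) lt
      adj : Adjacent (i , part m i + suc k) (i , part m i + k)
      adj = cong₂ _+_ (∣n-n∣≡0 i) (trans (cong (∣_- part m i + k ∣) (+-suc (part m i) k)) (∣1+n-n∣≡1 (part m i + k)))

    toRowStart : ∀ {i j} → skew p m (i , j) → Star Step (i , j) (i , part m i)
    toRowStart {i} (j<λ , j≮μ) with k , refl ← m≤n⇒∃[o]m+o≡n (≮⇒≥ j≮μ) = walkLeft k j<λ

    -- One box down, at the first removed column of the upper row, then left again.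
    toLastRow : ∀ d {i} → a ≤ i → i + d ≡ b → part m i < part p i → Star Step (i , part m i) (b , part m b)
    toLastRow zero    {i} a≤i refl μ<λ rewrite +-identityʳ i = ε
    toLastRow (suc d) {i} a≤i i+d≡b μ<λ =
      ((μ<λ , n≮n _) , below-in , cong₂ _+_ (∣n-1+n∣≡1 i) (∣n-n∣≡0 (part m i))) ◅
      (toRowStart below-in ◅◅ toLastRow d (m≤n⇒m≤1+n a≤i) (trans (sym (+-suc i d)) i+d≡b)
        (≤-<-trans (part-antitone m (n≤1+n i)) (proj₁ below-in)))
      where
      below-in : skew p m (suc i , part m i)
      below-in = ≤-reflexive (inside a≤i (subst (i <_) i+d≡b (m<m+n i z<s))) ,
                 ≤⇒≯ (part-antitone m (n≤1+n i))

    toCorner : ∀ {c} → skew p m c → Star Step c (b , part m b)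
    toCorner {i , j} s@(j<λ , j≮μ) with i <? a | i ≤? b
    ... | yes i<a | _       = ⊥-elim (j≮μ (subst (j <_) (sym (above i<a)) j<λ))
    ... | no  _   | no  i≰b = ⊥-elim (j≮μ (subst (j <_) (sym (below (≰⇒> i≰b))) j<λ))
    ... | no  i≮a | yes i≤b = toRowStart s ◅◅
      toLastRow (b ∸ i) (≮⇒≥ i≮a) (m+[n∸m]≡n i≤b) (≤-<-trans (≮⇒≥ j≮μ) j<λ)

  -- The lower left end of the hook serves as a hub: every box has a path to it, and paths can be
  -- reversed.
  hook⇒connected : Connected (skew p m)
  hook⇒connected c d sc sd = toCorner sc ◅◅ reverse step-sym (toCorner sd)

-- If `t + y` is a bead and `y` is not, the bead can be moved down to `y`. With `b` the last row
-- whose bead exceeds `y`, the position `y` falls in the gap after that bead, and the move strips a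
-- `t`-rim hook from rows `a` to `b`.
core⇒flush : ∀ {r t} p → ℓ p ≤ r → 0 < t → IsCore t p → Flush t (IsBead r p)
core⇒flush {r} {t} p ℓ≤r 0<t core y (a , a<r , bead≡) with isBead? r p y
... | yes y∈ = y∈
... | no  y∉
  with greatest (λ i → y <? bead r p i) a<r (subst (y <_) (sym bead≡) (m<n+m y 0<t))
... | b , a≤b , b<r , y<bead , final = ⊥-elim (core (m , m⊆p ,
        HookConnected.hook⇒connected p m hook , hook⇒no2×2 p m hook ,
        subst (HasCardinality (skew p m)) size (card-skew p m ℓ≤r)))
  where
  next<y : suc b < r → bead r p (suc b) < y
  next<y b+1<r = ≤∧≢⇒< (≮⇒≥ (final ≤-refl b+1<r)) (λ eq → y∉ (suc b , b+1<r , eq))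

  -- This says that the bead of row `suc b` is less than `y`, with the strictness absorbed into
  -- `r ∸ suc b`. When `b` is the last of the `r` rows there is no such bead and the left side is 0.
  next : part p (suc b) + (r ∸ suc b) ≤ y
  next with suc b <? r
  ... | yes b+1<r = ≤-trans
    (≤-reflexive (trans (cong (part p (suc b) +_) (+-∸-assoc 1 b+1<r)) (+-suc _ _)))
    (next<y b+1<r)
  ... | no  b+1≮r = subst (_≤ y) (sym (cong₂ _+_ (entry-beyond (parts p) (≤-trans ℓ≤r (≮⇒≥ b+1≮r)))
                                             (m≤n⇒m∸n≡0 (≮⇒≥ b+1≮r)))) z≤n

  -- The length of row `b` that puts its bead at `y`.
  v : ℕ
  v = y ∸ (r ∸ suc b)

  v+≡y : v + (r ∸ suc b) ≡ y
  v+≡y = m∸n+n≡m (≤-trans (m≤n+m (r ∸ suc b) (part p (suc b))) next)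

  module S = Strip {a} {b} {v} {part p} (entry-antitone-suc (decreasing p)) a≤b
    (+-cancelʳ-< (r ∸ suc b) _ _ (subst (_< bead r p b) (sym v+≡y) y<bead))
    (+-cancelʳ-≤ (r ∸ suc b) _ _ (subst (part p (suc b) + (r ∸ suc b) ≤_) (sym v+≡y) next))

  m : Partition
  m = fromSequence S.stripped S.stripped-antitone r

  part-m : ∀ i → part m i ≡ S.stripped i
  part-m = entry-takePositive S.stripped S.stripped-antitone r λ {i} r≤i →
    n≤0⇒n≡0 (subst (S.stripped i ≤_) (entry-beyond (parts p) (≤-trans ℓ≤r r≤i)) (S.stripped≤ i))

  m≤p : ∀ i → part m i ≤ part p i
  m≤p i = subst (_≤ part p i) (sym (part-m i)) (S.stripped≤ i)

  m⊆p : m ⊆ p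
  m⊆p (i , j) j<μ = <-≤-trans j<μ (m≤p i)

  hook : StripsHook (part p) (part m) a b
  hook = record
    { above  = λ {i} i<a → trans (part-m i) (S.above i<a)
    ; inside = λ {i} a≤i i<b → trans (cong suc (part-m i)) (S.inside a≤i i<b)
    ; last   = subst (_< part p b) (sym (part-m b)) S.last
    ; below  = λ {i} b<i → trans (part-m i) (S.below b<i)
    }

  part-m-b : part m b ≡ v
  part-m-b = trans (part-m b) S.at-end

  size : Σ[< r ] (λ i → part p i ∸ part m i) ≡ t
  size = +-cancelʳ-≡ y _ t (begin
    removed + y                            ≡⟨ cong (removed +_) (sym (trans (cong (_+ (r ∸ suc b)) part-m-b) v+≡y)) ⟩
    removed + (part m b + (r ∸ suc b))     ≡⟨ hook-bead m≤p a≤b b<r hook ⟩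
    bead r p a                             ≡⟨ bead≡ ⟩
    t + y                                  ∎)
    where
    open ≡-Reasoning
    removed = Σ[< r ] (λ i → part p i ∸ part m i)

-- Flush sets of beads on the t-abacus

pointwise⇒entry≤ : ∀ {xs ys} → Pointwise _≤_ xs ys → ∀ i → entry xs i ≤ entry ys i
pointwise⇒entry≤ []        i       = z≤n
pointwise⇒entry≤ (x≤y ∷ _) zero    = x≤y
pointwise⇒entry≤ (_ ∷ ≤s)  (suc i) = pointwise⇒entry≤ ≤s i

entry-applyUpTo : ∀ f {n i} → i < n → entry (applyUpTo f n) i ≡ f i
entry-applyUpTo f {suc n} {zero}  _         = refl
entry-applyUpTo f {suc n} {suc i} (s≤s i<n) = entry-applyUpTo (f ∘ suc) i<n

applyUpTo-pointwise : ∀ {f g : ℕ → ℕ} n → (∀ i → f i ≤ g i) →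
  Pointwise _≤_ (applyUpTo f n) (applyUpTo g n)
applyUpTo-pointwise zero    f≤g = []
applyUpTo-pointwise (suc n) f≤g = f≤g 0 ∷ applyUpTo-pointwise n (f≤g ∘ suc)

entries≡-length⇒≡ : ∀ {xs ys} → length xs ≡ length ys →
  (∀ {i} → i < length xs → entry xs i ≡ entry ys i) → xs ≡ ys
entries≡-length⇒≡ {[]}    {[]}    _   _  = refl
entries≡-length⇒≡ {_ ∷ _} {_ ∷ _} len eq =
  cong₂ _∷_ (eq z<s) (entries≡-length⇒≡ (suc-injective len) (eq ∘ s<s))

module Abacus (t : ℕ) .{{_ : NonZero t}} where

  runnerSize : ℕ → ℕ → ℕ
  runnerSize n i = (n + t ∸ 1 ∸ i) / t

  -- The quotient is (n - i) / t rounded up, which counts the levels of runner `i` below `n`. The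
  -- added `t` also keeps the subtraction exact when `n` ≤ `i`, where the count is 0.
  <runnerSize : ∀ {n i q} → i < t → q < runnerSize n i ⇔ i + q * t < n
  <runnerSize {n} {i} {q} i<t = mk⇔ ⇒ ⇐
    where
    i<n+t : i < n + t
    i<n+t = <-≤-trans i<t (m≤n+m t n)
    room : n + t ∸ 1 ∸ i ≡ n + t ∸ suc i
    room = ∸-+-assoc (n + t) 1 i
    regroup : suc q * t + suc i ≡ suc (i + q * t) + t
    regroup = begin
      t + q * t + suc i    ≡⟨ +-assoc t (q * t) (suc i) ⟩
      t + (q * t + suc i)  ≡⟨ +-comm t _ ⟩
      q * t + suc i + t    ≡⟨ cong (_+ t) (+-comm (q * t) (suc i)) ⟩
      suc (i + q * t) + t  ∎
      where open ≡-Reasoning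
    ⇒ : q < runnerSize n i → i + q * t < n
    ⇒ q< = +-cancelʳ-≤ t _ _ (subst (_≤ n + t) regroup
      (m≤o∸n⇒m+n≤o (suc q * t) i<n+t
        (subst (suc q * t ≤_) room (≤-trans (*-monoˡ-≤ t q<) (m/n*n≤m _ t)))))
    ⇐ : i + q * t < n → q < runnerSize n i
    ⇐ x< = subst (_≤ runnerSize n i) (m*n/n≡m (suc q) t) (/-monoˡ-≤ t
      (subst (suc q * t ≤_) (sym room)
        (m+n≤o⇒m≤o∸n (suc q * t) (subst (_≤ n + t) (sym regroup) (+-monoˡ-≤ t x<)))))

  runner : ∀ {i} q → i < t → (i + q * t) % t ≡ i
  runner {i} q i<t = trans ([m+kn]%n≡m%n i q t) (m<n⇒m%n≡m i<t)

  level : ∀ {i} q → i < t → (i + q * t) / t ≡ q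
  level {i} q i<t = begin
    (i + q * t) / t      ≡⟨ +-distrib-/-∣ʳ i (n∣m*n q) ⟩
    i / t + q * t / t    ≡⟨ cong₂ _+_ (m<n⇒m/n≡0 i<t) (m*n/n≡m q t) ⟩
    q                    ∎
    where open ≡-Reasoning

  -- The set with the lowest cᵢ positions of each runner i, where cs = c₀, c₁, ….
  Pushed : List ℕ → ℕ → Set
  Pushed cs x = x / t < entry cs (x % t)

  pushed? : ∀ cs → Decidable (Pushed cs)
  pushed? cs x = x / t <? entry cs (x % t)

  pushed-flush : ∀ cs → Flush t (Pushed cs)
  pushed-flush cs y pushed =
    ≤-<-trans (/-monoˡ-≤ t (m≤n+m y t)) (subst (λ i → (t + y) / t < entry cs i) same-runner pushed)
    where
    same-runner : (t + y) % t ≡ y % t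
    same-runner = trans (cong (_% t) (+-comm t y)) ([m+n]%n≡m%n y t)

  pushed⇔ : ∀ {cs i} q → i < t → Pushed cs (i + q * t) ⇔ q < entry cs i
  pushed⇔ {cs} {i} q i<t = mk⇔ (subst id eq) (subst id (sym eq))
    where
    eq : Pushed cs (i + q * t) ≡ (q < entry cs i)
    eq = cong₂ (λ a b → a < entry cs b) (level q i<t) (runner q i<t)

  -- The runner is scanned downwards from level `n`: the first occupied level found fills all levels
  -- under it, by flushness.
  height : ∀ {B : ℕ → Set} → Decidable B → Flush t B → ∀ i n →
    ∃ λ k → k ≤ n × (∀ {q} → q < n → B (i + q * t) ⇔ q < k)
  height         B? flush i zero    = 0 , z≤n , λ ()
  height {B} B? flush i (suc n) with B? (i + n * t)
  ... | yes full = suc n , ≤-refl , λ {q} q<1+n → mk⇔ (λ _ → q<1+n) (λ _ → filled (≤⇒≤′ (s≤s⁻¹ q<1+n)) full)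
    where
    filled : ∀ {q k} → q ≤′ k → B (i + k * t) → B (i + q * t)
    filled ≤′-refl                  b = b
    filled {k = suc k} (≤′-step q≤k) b = filled q≤k (flush (i + k * t) (subst B swap b))
      where
      swap : i + (t + k * t) ≡ t + (i + k * t)
      swap = trans (sym (+-assoc i t _)) (trans (cong (_+ k * t) (+-comm i t)) (+-assoc t i _))
  ... | no empty with k , k≤n , iff ← height {B} B? flush i n = k , m≤n⇒m≤1+n k≤n , iff′
    where
    iff′ : ∀ {q} → q < suc n → B (i + q * t) ⇔ q < k
    iff′ {q} (s≤s q≤n) with m≤n⇒m<n∨m≡n q≤n
    ... | inj₁ q<n  = iff q<n
    ... | inj₂ refl = mk⇔ (⊥-elim ∘ empty) (λ n<k → ⊥-elim (<⇒≱ n<k k≤n))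

  Fits : ℕ → List ℕ → Set
  Fits n cs = Pointwise _≤_ cs (applyUpTo (runnerSize n) t)

  module _ n {cs} (fits : Fits n cs) where

    fits-length : length cs ≡ t
    fits-length = trans (Pointwise-length fits) (length-applyUpTo (runnerSize n) t)

    fits-entry : ∀ {i} → i < t → entry cs i ≤ runnerSize n i
    fits-entry {i} i<t = subst (entry cs i ≤_) (entry-applyUpTo (runnerSize n) i<t)
      (pointwise⇒entry≤ fits i)

    pushed⇒< : ∀ {x} → Pushed cs x → x < n
    pushed⇒< {x} pushed = subst (_< n) (sym (m≡m%n+[m/n]*n x t))
      (to (<runnerSize x%t<t) (<-≤-trans pushed (fits-entry x%t<t)))
      where
      x%t<t : x % t < t
      x%t<t = m%n<n x t

    -- Division with remainder by `t` identifies the set with the boxes of `t` left-justified rows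
    -- of lengths cᵢ.
    card-pushed : HasCardinality (Pushed cs) (sum cs)
    card-pushed = subst (HasCardinality (Pushed cs))
      (sym (trans (sum≡Σ-entry cs) (cong (λ l → Σ[< l ] (entry cs)) fits-length)))
      (card-image (λ (i , q) → i + q * t) inj
        (λ {(i , q)} (i<t , _ , q<) → from (pushed⇔ {cs} q i<t) q<)
        (λ {x} pushed → (x % t , x / t) , (m%n<n x t , z≤n , pushed) , sym (m≡m%n+[m/n]*n x t))
        (card-between t (λ _ → 0) (entry cs)))
      where
      inj : ∀ {b c} → proj₁ b < t × Between (λ _ → 0) (entry cs) b →
        proj₁ c < t × Between (λ _ → 0) (entry cs) c →
        proj₁ b + proj₂ b * t ≡ proj₁ c + proj₂ c * t → b ≡ c
      inj {i , q} {i′ , q′} (i<t , _) (i′<t , _) eq = cong₂ _,_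
        (trans (sym (runner q i<t)) (trans (cong (_% t) eq) (runner q′ i′<t)))
        (trans (sym (level q i<t)) (trans (cong (_/ t) eq) (level q′ i′<t)))

  -- Otherwise the lowest empty position on runner `i` of `cs′`, at level `entry cs′ i`, would be
  -- occupied for `cs`.
  pushed-⊆⇒entry≤ : ∀ n {cs cs′} → Fits n cs → (∀ {x} → Pushed cs x → Pushed cs′ x) →
    ∀ {i} → i < t → entry cs i ≤ entry cs′ i
  pushed-⊆⇒entry≤ n {cs} {cs′} fits ⊆ {i} i<t = ≮⇒≥ λ c′<c →
    n≮n _ (to (pushed⇔ {cs′} (entry cs′ i) i<t) (⊆ (from (pushed⇔ {cs} (entry cs′ i) i<t) c′<c)))

  -- The bijection between bounded tuples and cores in the rectangle

  module InRectangle (r s : ℕ) where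

    Valid : List ℕ → Set
    Valid = BoundedTuple (applyUpTo (runnerSize (r + s)) t) r

    pushedList : List ℕ → List ℕ
    pushedList cs = filter (pushed? cs) (downFrom (r + s))

    pushedList-decreasing : ∀ cs → Linked _>_ (pushedList cs)
    pushedList-decreasing cs = Linked.filter⁺ (pushed? cs) (λ x>y y>z → <-trans y>z x>y)
      (Linked.applyDownFrom⁺₂ id (r + s) n<1+n)

    -- Defined for every tuple, with as many beads as `pushedList cs` has entries; validity makes
    -- that number `r`.
    toPartition : List ℕ → Partition
    toPartition cs = FromBeads.fromBeads (pushedList-decreasing cs)

    module _ {cs} (valid : Valid cs) where

      private
        fits : Fits (r + s) cs
        fits = proj₁ valid

      pushedList-length : length (pushedList cs) ≡ r
      pushedList-length = trans
        (card-unique (mk⇔ proj₂ λ pushed → pushed⇒< (r + s) fits pushed , pushed)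
          (card-filter (pushed? cs) (r + s)) (card-pushed (r + s) fits))
        (proj₂ valid)

      toPartition-ℓ : ℓ (toPartition cs) ≤ r
      toPartition-ℓ = subst (ℓ (toPartition cs) ≤_) pushedList-length
        (FromBeads.fromBeads-ℓ (pushedList-decreasing cs))

      isBead⇔pushed : ∀ {y} → IsBead r (toPartition cs) y ⇔ Pushed cs y
      isBead⇔pushed {y} =
        mk⇔ (λ y∈ → proj₂ (∈-filter⁻ (pushed? cs) {xs = downFrom (r + s)} y∈))
            (λ pushed → ∈-filter⁺ (pushed? cs) (∈-downFrom⁺ (pushed⇒< (r + s) fits pushed)) pushed)
        ⇔-∘ subst (λ r → IsBead r (toPartition cs) y ⇔ y ∈ pushedList cs) pushedList-length
              (FromBeads.isBead-fromBeads (pushedList-decreasing cs))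

      toPartition-core : IsCore t (toPartition cs)
      toPartition-core = flush⇒core (toPartition cs) toPartition-ℓ (>-nonZero⁻¹ t)
        λ y → from isBead⇔pushed ∘ pushed-flush cs y ∘ to isBead⇔pushed

      -- Row 0 has a bead because `r` is nonzero. It is λ₁ + r - 1, so the bound `r + s` on it is
      -- the bound `s` on λ₁.
      toPartition-fits : .{{_ : NonZero r}} → FitsIn r s (toPartition cs)
      toPartition-fits = toPartition-ℓ , +-cancelʳ-≤ r _ _ (begin
        part p 0 + r            ≡⟨ cong (part p 0 +_) (sym (suc-pred r)) ⟩
        part p 0 + suc (pred r) ≡⟨ +-suc _ _ ⟩
        suc (bead r p 0)        ≤⟨ pushed⇒< (r + s) fits (to isBead⇔pushed (0 , >-nonZero⁻¹ r , refl)) ⟩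
        r + s                   ≡⟨ +-comm r s ⟩
        s + r                   ∎)
        where
        open ≤-Reasoning
        p = toPartition cs

    beads-⊆ : ∀ {cs cs′} → Valid cs → Valid cs′ → toPartition cs ≡ toPartition cs′ →
      ∀ {x} → Pushed cs x → Pushed cs′ x
    beads-⊆ v v′ eq {x} = to (isBead⇔pushed v′) ∘ subst (λ p → IsBead r p x) eq ∘ from (isBead⇔pushed v)

    toPartition-injective : ∀ {cs cs′} → Valid cs → Valid cs′ →
      toPartition cs ≡ toPartition cs′ → cs ≡ cs′
    toPartition-injective {cs} {cs′} v@(fits , _) v′@(fits′ , _) eq =
      entries≡-length⇒≡ (trans (fits-length n fits) (sym (fits-length n fits′))) λ {i} i< →
        let i<t = subst (i <_) (fits-length n fits) i< in
        ≤-antisym (pushed-⊆⇒entry≤ n {cs} {cs′} fits (λ {x} → beads-⊆ v v′ eq {x}) i<t)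
                  (pushed-⊆⇒entry≤ n {cs′} {cs} fits′ (λ {x} → beads-⊆ v′ v (sym eq) {x}) i<t)
      where
      n = r + s

    isBead⇒< : ∀ p → FitsIn r s p → ∀ {y} → IsBead r p y → y < r + s
    isBead⇒< p (_ , λ₀≤s) (i , i<r , refl) = begin-strict
      bead r p i  <⟨ +-mono-≤-< (≤-trans (part-antitone p z≤n) λ₀≤s) (∸-monoʳ-< z<s i<r) ⟩
      s + r       ≡⟨ +-comm s r ⟩
      r + s       ∎
      where open ≤-Reasoning

    toPartition-surjective : ∀ {p} → IsCore t p × FitsIn r s p →
      ∃ λ cs → Valid cs × toPartition cs ≡ p
    toPartition-surjective {p} (core , fit@(ℓ≤r , _)) =
      cs , valid ,
      beads-determine r (toPartition cs) p (toPartition-ℓ valid) ℓ≤r (pushed⇔isBead ⇔-∘ isBead⇔pushed valid)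
      where
      flush : Flush t (IsBead r p)
      flush = core⇒flush p ℓ≤r (>-nonZero⁻¹ t) core

      -- The search can stop at `runnerSize (r + s) i`, since the beads of a partition inside the
      -- rectangle are below `r + s`.
      heightOf : ∀ i → _
      heightOf i = height (isBead? r p) flush i (runnerSize (r + s) i)

      k : ℕ → ℕ
      k i = proj₁ (heightOf i)

      cs : List ℕ
      cs = applyUpTo k t

      fits : Fits (r + s) cs
      fits = applyUpTo-pointwise t (λ i → proj₁ (proj₂ (heightOf i)))

      on-runner : ∀ {i} q → i < t → q < runnerSize (r + s) i →
        Pushed cs (i + q * t) ⇔ IsBead r p (i + q * t)
      on-runner {i} q i<t q< =
        ⇔-sym (proj₂ (proj₂ (heightOf i)) q<) ⇔-∘
        subst (λ c → Pushed cs (i + q * t) ⇔ q < c) (entry-applyUpTo k i<t) (pushed⇔ {cs} q i<t)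

      pushed⇔isBead : ∀ {x} → Pushed cs x ⇔ IsBead r p x
      pushed⇔isBead {x} = mk⇔
        (λ pushed → to (here⇔ (pushed⇒< (r + s) fits pushed)) pushed)
        (λ isBead → from (here⇔ (isBead⇒< p fit isBead)) isBead)
        where
        here⇔ : x < r + s → Pushed cs x ⇔ IsBead r p x
        here⇔ x< = subst (λ x → Pushed cs x ⇔ IsBead r p x) (sym x≡)
          (on-runner (x / t) (m%n<n x t) (from (<runnerSize {r + s} (m%n<n x t)) (subst (_< r + s) x≡ x<)))
          where
          x≡ = m≡m%n+[m/n]*n x t

      -- The same set has `sum cs` elements as a pushed set and `r` elements as the set of beads of
      -- `p`.
      valid : Valid cs
      valid = fits , card-unique pushed⇔isBead (card-pushed (r + s) fits) (card-IsBead r p)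

    card-cores : .{{_ : NonZero r}} → HasCardinality (λ p → IsCore t p × FitsIn r s p)
      ([q^ r ] foldr _⊗_ (1 ∷ []) (map geometric (applyUpTo (runnerSize (r + s)) t)))
    card-cores = card-image toPartition toPartition-injective
      (λ v → toPartition-core v , toPartition-fits v) toPartition-surjective
      (card-boundedTuple (applyUpTo (runnerSize (r + s)) t) r)

proposition3p5 : (r s t : ℕ) .{{_ : NonZero r}} .{{_ : NonZero s}} .{{_ : NonTrivial t}} →
    HasCardinality (λ p → IsCore t p × FitsIn r s p)
    ([q^ r ] ∏[< t ] (λ i → geometric (nᵢ r s t i)))
proposition3p5 r s t = subst (λ fs → HasCardinality (λ p → IsCore t p × FitsIn r s p) ([q^ r ] foldr _⊗_ (1 ∷ []) fs))
  (trans (map-applyUpTo (nᵢ r s t) geometric t) (sym (map-upTo (geometric ∘ nᵢ r s t) t)))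
  card-cores
  where
  instance
    t≢0 : NonZero t
    t≢0 = nonTrivial⇒nonZero t
  open Abacus.InRectangle t r s
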